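{- Let $q$ be an odd prime power, $d\ge2$, $Q$ a nondegenerate quadratic form on $\mathbb F_q^d$. Let $P\subseteq\mathbb F_q^d$ be nonempty, let $\mathcal S$ be a nonempty family of distinct $Q$-spheres, and let $K>0$. Assume $$\sigma(P,\mathcal S)\ge Kq^{(d-1)/2}\sqrt{|P||\mathcal S|}.$$ Let $0<\varepsilon\le1$ and suppose $$\varepsilon^2K^2q^{d-1}|\mathcal S|\ge4|P|.$$ Then $P$ has a partition $P=R_1\sqcup\cdots\sqcup R_T\sqcup P_{\mathrm{rem}}$ with the following properties. (1) For every $j$ there is a nonconcentric pair $(S_j,S_j')\in\mathcal S^2$ such that $$R_j\subseteq P_{\mathrm{pos}}\cap S_j\cap S_j',\qquad|R_j|\ge\frac{\varepsilon^2K^2q^{d-1}}{4|\mathcal S|}.$$ (2) $\sigma(R_j)>0$ for every $j$. (3) The number of pieces satisfies $$T\le\frac{4|P||\mathcal S|}{\varepsilon^2K^2q^{d-1}}.$$ (4) $\sigma(P_{\mathrm{rem}})<\varepsilon\,\sigma(P,\mathcal S)$ and $$\sum_{j=1}^T\sigma(R_j)>(1-\varepsilon)\sigma(P,\mathcal S).$$ If $|\mathcal S|\le C_1Kq^{(d-1)/2}$, then every piece $R_j$ has size at least $\dfrac{\varepsilon^2Kq^{(d-1)/2}}{4C_1}$.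
   Context: For $c\in\mathbb F_q^d$, $r\in\mathbb F_q$ the $Q$-sphere is $S_Q(c,r)=\{x\in\mathbb F_q^d:Q(x-c)=r\}$; spheres are parametrized by pairs $(c,r)$ and distinct spheres means distinct parameter pairs. Two spheres are nonconcentric if their centers differ. $\sigma(P,\mathcal S)=|\{(p,S)\in P\times\mathcal S:p\in S\}|-|P||\mathcal S|/q$. For $p\in\mathbb F_q^d$, $d_{\mathcal S}(p)=|\{S\in\mathcal S:p\in S\}|$ and $e_{\mathcal S}(p)=d_{\mathcal S}(p)-|\mathcal S|/q$. $P_{\mathrm{pos}}=\{p\in P:e_{\mathcal S}(p)>0\}$, and for $A\subseteq P$, $\sigma(A)=\sum_{p\in A}e_{\mathcal S}(p)=\sigma(A,\mathcal S)$. -}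

module Defs where

open import Algebra.Bundles using (CommutativeRing; Semiring)
open import Algebra.Structures using (IsCommutativeRing)
open import Data.Fin as Fin using (Fin)
import Data.Fin.Properties as Fin
open import Data.List using (List; []; map; foldr; length; filter; cartesianProduct)
open import Data.List.Membership.Propositional using (_∈_)
open import Data.List.Relation.Unary.Unique.Propositional using (Unique)
open import Data.Nat as ℕ using (ℕ; suc)
open import Data.Nat.Divisibility using () renaming (_∣_ to _∣ℕ_)
open import Data.Nat.Primality using (Prime)
open import Data.Product using (_×_; _,_; proj₁; proj₂; ∃-syntax)
open import Data.Vec as Vec using (Vec)
open import Function.Bundles using (_↔_)
open import Function.Properties.Inverse using (↔⇒↣)
open import Level using (0ℓ)
open import Relation.Binary.Definitions using (DecidableEquality)
open import Relation.Binary.PropositionalEquality using (_≡_; _≢_)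
import Relation.Binary.Construct.StrictToNonStrict as StrictToNonStrict
open import Relation.Binary.Structures using (IsStrictTotalOrder)
open import Relation.Nullary using (¬_; Dec)
open import Relation.Nullary.Decidable using (via-injection)
open import Relation.Unary using (Pred)

-- The (classical) real numbers, characterised up to isomorphism as a
-- Dedekind-complete totally ordered field.  Square roots of nonnegative
-- elements exist and are unique in any such field; √ only names them.
record RealField : Set₁ where
  infix  4 _≈_ _<_
  infixl 6 _+_
  infixl 7 _*_
  infix  8 -_
  infix  9 _⁻¹
  field
    ℝ       : Set
    _≈_ _<_ : ℝ → ℝ → Set
    _+_ _*_ : ℝ → ℝ → ℝ
    -_      : ℝ → ℝ
    0# 1#   : ℝ
    _⁻¹     : ℝ → ℝ   -- unspecified at 0
    √       : ℝ → ℝ   -- unspecified at negative elements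

    isCommutativeRing  : IsCommutativeRing _≈_ _+_ _*_ -_ 0# 1#
    isStrictTotalOrder : IsStrictTotalOrder _≈_ _<_

  open StrictToNonStrict _≈_ _<_ public using (_≤_)

  field
    0<1        : 0# < 1#
    +-monoˡ-<  : ∀ z {x y} → x < y → (x + z) < (y + z)
    *-pos      : ∀ {x y} → 0# < x → 0# < y → 0# < (x * y)
    ⁻¹-cong    : ∀ {x y} → x ≈ y → x ⁻¹ ≈ y ⁻¹
    ⁻¹-inverse : ∀ {x} → ¬ (x ≈ 0#) → (x * x ⁻¹) ≈ 1#
    √-cong     : ∀ {x y} → x ≈ y → √ x ≈ √ y
    √-nonneg   : ∀ {x} → 0# ≤ x → 0# ≤ √ x
    √-square   : ∀ {x} → 0# ≤ x → (√ x * √ x) ≈ x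
    complete   : (A : Pred ℝ 0ℓ) →
                 (∃[ x ] A x) →
                 (∃[ b ] (∀ {x} → A x → x ≤ b)) →
                 ∃[ s ] ((∀ {x} → A x → x ≤ s) ×
                         (∀ {b} → (∀ {x} → A x → x ≤ b) → s ≤ b))

  commutativeRing : CommutativeRing 0ℓ 0ℓ
  commutativeRing = record { isCommutativeRing = isCommutativeRing }

  open CommutativeRing commutativeRing public using (_-_; semiring)
  open import Algebra.Definitions.RawSemiring (Semiring.rawSemiring semiring) public
    using (_^_; sum) renaming (_×_ to _×ℝ_)

  infixl 7 _/_
  _/_ : ℝ → ℝ → ℝ
  x / y = x * y ⁻¹

  ι : ℕ → ℝ
  ι n = n ×ℝ 1#

  sumOver : {A : Set} → (A → ℝ) → List A → ℝ
  sumOver f xs = foldr _+_ 0# (map f xs)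

  -- The half-integral power n^(m/2), as (√n)^m.
  _^[_/2] : ℕ → ℕ → ℝ
  n ^[ m /2] = √ (ι n) ^ m

OddPrimePower : ℕ → Set
OddPrimePower q = (∃[ p ] ∃[ k ] (Prime p × q ≡ p ℕ.^ suc k)) × ¬ (2 ∣ℕ q)

record FiniteField (q : ℕ) : Set₁ where
  infixl 6 _+_ _-_
  infixl 7 _*_
  infix  8 -_
  field
    F       : Set
    _+_ _*_ : F → F → F
    -_      : F → F
    0# 1#   : F
    isCommutativeRing : IsCommutativeRing _≡_ _+_ _*_ -_ 0# 1#
    0≢1     : 0# ≢ 1#
    inverse : ∀ x → x ≢ 0# → ∃[ y ] x * y ≡ 1#
    enum    : F ↔ Fin q

  _-_ : F → F → F
  x - y = x + (- y)

  _≟_ : DecidableEquality F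
  _≟_ = via-injection (↔⇒↣ enum) Fin._≟_

-- Finite subsets, as repetition-free lists.
record FinSet (A : Set) : Set where
  field
    elements : List A
    unique   : Unique elements

  ∣_∣ : ℕ
  ∣_∣ = length elements

  Nonempty : Set
  Nonempty = elements ≢ []

open FinSet public

module _ {q : ℕ} (𝔽 : FiniteField q) where
  open FiniteField 𝔽

  Point : ℕ → Set
  Point d = Vec F d

  infixl 6 _+ᵥ_ _-ᵥ_
  infixr 7 _·ᵥ_

  _+ᵥ_ _-ᵥ_ : ∀ {d} → Point d → Point d → Point d
  _+ᵥ_ = Vec.zipWith _+_
  _-ᵥ_ = Vec.zipWith _-_

  _·ᵥ_ : ∀ {d} → F → Point d → Point d
  a ·ᵥ x = Vec.map (a *_) x

  0ᵥ : ∀ {d} → Point d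
  0ᵥ = Vec.replicate _ 0#

  record QuadraticForm (d : ℕ) : Set where
    field
      form        : Point d → F
      homogeneous : ∀ a x → form (a ·ᵥ x) ≡ (a * a) * form x

    polar : Point d → Point d → F
    polar x y = (form (x +ᵥ y) - form x) - form y

    -- polar is symmetric, so linearity on the left is bilinearity.
    field
      polar-+ˡ : ∀ x y z → polar (x +ᵥ y) z ≡ polar x z + polar y z
      polar-·ˡ : ∀ a x z → polar (a ·ᵥ x) z ≡ a * polar x z

    Nondegenerate : Set
    Nondegenerate = ∀ x → (∀ y → polar x y ≡ 0#) → x ≡ 0ᵥ

  -- A sphere is its parameter pair (c , r), so equality of spheres is
  -- equality of parameters.
  Sphere : ℕ → Set
  Sphere d = Point d × F

module Incidence (𝓡 : RealField) {q : ℕ} (𝔽 : FiniteField q)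
                 {d : ℕ} (Q : QuadraticForm 𝔽 d) where
  private module 𝔽 = FiniteField 𝔽
  open RealField 𝓡
  open QuadraticForm Q using (form)

  infix 4 _∈ˢ_ _∈ˢ?_

  _∈ˢ_ : Point 𝔽 d → Sphere 𝔽 d → Set
  x ∈ˢ (c , r) = form (_-ᵥ_ 𝔽 x c) ≡ r

  _∈ˢ?_ : ∀ x S → Dec (x ∈ˢ S)
  x ∈ˢ? (c , r) = form (_-ᵥ_ 𝔽 x c) 𝔽.≟ r

  Nonconcentric : Sphere 𝔽 d → Sphere 𝔽 d → Set
  Nonconcentric S S′ = proj₁ S ≢ proj₁ S′

  incidences : FinSet (Point 𝔽 d) → FinSet (Sphere 𝔽 d) → ℕ
  incidences P 𝓢 =
    length (filter (λ pS → proj₁ pS ∈ˢ? proj₂ pS)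
                   (cartesianProduct (elements P) (elements 𝓢)))

  σ : FinSet (Point 𝔽 d) → FinSet (Sphere 𝔽 d) → ℝ
  σ P 𝓢 = ι (incidences P 𝓢) - (ι ∣ P ∣ * ι ∣ 𝓢 ∣) / ι q

  module _ (𝓢 : FinSet (Sphere 𝔽 d)) where

    degree : Point 𝔽 d → ℕ
    degree p = length (filter (p ∈ˢ?_) (elements 𝓢))

    excess : Point 𝔽 d → ℝ
    excess p = ι (degree p) - ι ∣ 𝓢 ∣ / ι q

    Pos : FinSet (Point 𝔽 d) → Pred (Point 𝔽 d) 0ℓ
    Pos P p = p ∈ elements P × 0# < excess p

    σ[_]_ : FinSet (Point 𝔽 d) → ℝ
    σ[_]_ A = sumOver excess (elements A)

{-# OPTIONS --safe #-}

-- Put L = ε²K²q^(d-1), m = L/(4|𝓢|) and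
-- t = εKq^((d-1)/2)√(|P||𝓢|)/|P|, so that t²|P| = L|𝓢| and the size hypothesis
-- reads t ≥ 2.  Suppose A ⊆ P still has σ(A) ≥ εσ(P), hence Σ d(p) ≥ t|P| over
-- B = A_pos.  Summing 2t d(p) ≤ d(p)² + t² gives a lower bound for Σ d(p)²; on
-- the other hand distinct concentric spheres are disjoint, so Σ d(p)² - Σ d(p)
-- is at most the number of incidences of B with intersections S ∩ S′ of
-- nonconcentric pairs.  If every such intersection had fewer than m points of
-- B, these bounds would contradict each other; so some B ∩ S ∩ S′ has at least
-- m points and can be split off.  Repeating this leaves σ(P_rem) < εσ(P), and
-- disjointness of the pieces bounds their number by |P|/m.
module Submission where

open import Defs
open import Data.Fin using (Fin)
open import Data.List using (_++_; concat; tabulate)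
open import Data.List.Membership.Propositional using (_∈_)
open import Data.List.Relation.Binary.Permutation.Propositional using (_↭_)
open import Data.Nat as ℕ using (ℕ; _∸_)
open import Data.Product using (_×_; Σ-syntax)

open import Algebra.Bundles using (CommutativeRing)
open import Data.Bool using (true; false)
open import Data.Empty using (⊥)
open import Data.Fin using (zero; suc)
open import Data.List using (List; []; _∷_; map; filter; length; cartesianProduct)
import Data.List.Properties as List
open import Data.List.Membership.Propositional using (find; lose)
open import Data.List.Membership.Propositional.Properties
  using (∈-filter⁻; ∈-cartesianProduct⁻)
open import Data.List.Relation.Binary.Permutation.Propositional
  using (↭ₛ⇒↭; ↭-refl; ↭-trans; ↭-reflexive; ↭⇒↭ₛ′)
import Data.List.Relation.Binary.Permutation.Propositional.Properties as ↭
import Data.List.Relation.Binary.Permutation.Setoid.Properties as Permutationₛ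
open import Data.List.Relation.Unary.All using (_∷_)
open import Data.List.Relation.Unary.AllPairs using (_∷_)
open import Data.List.Relation.Unary.Any using (here; there; any?)
open import Data.List.Relation.Unary.Unique.Propositional using (Unique)
import Data.List.Relation.Unary.Unique.Propositional.Properties as Unique
open import Data.Nat using (zero; suc)
open import Data.Nat.Induction using (<-wellFounded)
open import Data.Nat.Divisibility using (_∣0)
import Data.Nat.ListAction as ℕ
import Data.Nat.Properties as ℕ
open import Data.Product using (_,_; proj₁; proj₂; ∃; ∃₂; ∃-syntax)
open import Data.Sum using (_⊎_; inj₁; inj₂; [_,_])
import Data.Vec.Properties as Vec
open import Function using (_∘_)
open import Induction.WellFounded using (Acc; acc)
open import Level using (0ℓ)
open import Relation.Binary.Bundles using (StrictTotalOrder)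
open import Relation.Binary.Definitions using (tri<; tri≈; tri>)
open import Relation.Binary.PropositionalEquality as ≡ using (_≡_; _≢_; refl; sym; trans; cong; cong₂; subst)
open import Relation.Nullary using (¬_; Dec; yes; no; does; contradiction; _because_; ¬?; _×-dec_)
open import Relation.Unary using (Pred; Decidable)
open import Relation.Unary.Properties using (_∩?_; ∁?)

-- Counting in finite lists: filters, products and double counting.

module Counting where
  open import Data.Nat using (_+_; _*_; _≤_; z≤n; s≤s)
  open import Data.Nat.ListAction using (sum)
  open import Data.Nat.Properties
  open import Algebra.Properties.CommutativeSemigroup +-commutativeSemigroup using (interchange; x∙yz≈y∙xz)

  module _ {a} {A : Set a} where

    sum-map-mono-≤ : ∀ {f g : A → ℕ} (xs : List A) → (∀ {x} → x ∈ xs → f x ≤ g x) →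
                     sum (map f xs) ≤ sum (map g xs)
    sum-map-mono-≤ []       f≤g = z≤n
    sum-map-mono-≤ (x ∷ xs) f≤g = +-mono-≤ (f≤g (here refl)) (sum-map-mono-≤ xs (f≤g ∘ there))

    sum-map-+ : ∀ (f g : A → ℕ) xs →
                sum (map (λ x → f x + g x) xs) ≡ sum (map f xs) + sum (map g xs)
    sum-map-+ f g []       = refl
    sum-map-+ f g (x ∷ xs) =
      trans (cong (f x + g x +_) (sum-map-+ f g xs)) (interchange (f x) (g x) _ _)

    length-filter-⊎ : ∀ {p q r} {P : Pred A p} {Q : Pred A q} {R : Pred A r}
                      (P? : Decidable P) (Q? : Decidable Q) (R? : Decidable R) →
                      (∀ {x} → P x → Q x ⊎ R x) → ∀ xs →
                      length (filter P? xs) ≤ length (filter Q? xs) + length (filter R? xs)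
    length-filter-⊎ P? Q? R? P⊆Q∪R [] = z≤n
    length-filter-⊎ P? Q? R? P⊆Q∪R (x ∷ xs)
      with ih ← length-filter-⊎ P? Q? R? P⊆Q∪R xs | P? x | Q? x | R? x
    ... | false because _ | false because _ | false because _ = ih
    ... | false because _ | false because _ | true  because _ = ≤-trans ih (+-monoʳ-≤ _ (n≤1+n _))
    ... | false because _ | true  because _ | false because _ = m≤n⇒m≤1+n ih
    ... | false because _ | true  because _ | true  because _ =
      m≤n⇒m≤1+n (≤-trans ih (+-monoʳ-≤ _ (n≤1+n _)))
    ... | true  because _ | true  because _ | false because _ = s≤s ih
    ... | true  because _ | true  because _ | true  because _ =
      s≤s (≤-trans ih (+-monoʳ-≤ _ (n≤1+n _)))
    ... | true  because _ | false because _ | true  because _ =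
      ≤-trans (s≤s ih) (≤-reflexive (sym (+-suc _ _)))
    -- Of the eight cases, this is the only one in which the left side grows and the right side does
    -- not; the hypothesis excludes it.
    ... | yes p | no ¬q | no ¬r = contradiction (P⊆Q∪R p) [ ¬q , ¬r ]

    length-filter-unique : ∀ {p} {P : Pred A p} (P? : Decidable P) {xs} → Unique xs →
                           (∀ {x y} → x ∈ xs → y ∈ xs → P x → P y → x ≡ y) →
                           length (filter P? xs) ≤ 1
    length-filter-unique P? {xs} xs! P⇒≡ = at-most-one (filter P? xs) (Unique.filter⁺ P? xs!)
      λ x∈ y∈ → let x∈xs , px = ∈-filter⁻ P? x∈; y∈xs , py = ∈-filter⁻ P? y∈ in P⇒≡ x∈xs y∈xs px py
      where
      at-most-one : ∀ ys → Unique ys → (∀ {x y} → x ∈ ys → y ∈ ys → x ≡ y) → length ys ≤ 1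
      at-most-one []          _                   _  = z≤n
      at-most-one (_ ∷ [])    _                   _  = s≤s z≤n
      at-most-one (_ ∷ _ ∷ _) ((x≢y ∷ _) ∷ _) all≡ =
        contradiction (all≡ (here refl) (there (here refl))) x≢y

    -- Sum the bound over the filtered elements, then let the sum of `g` run over all of `xs`, which
    -- can only enlarge it. With `n` the degree of a point, a bound for each sphere through the
    -- point becomes a bound on the square of the degree.
    *-length-filter-≤ : ∀ {p} {P : Pred A p} (P? : Decidable P) {n} {g : A → ℕ} →
                        (∀ {x} → P x → n ≤ 1 + g x) → ∀ xs →
                        length (filter P? xs) * n ≤ length (filter P? xs) + sum (map g xs)
    *-length-filter-≤ P? n≤1+g [] = z≤n
    *-length-filter-≤ P? {n} {g} n≤1+g (x ∷ xs) with ih ← *-length-filter-≤ P? n≤1+g xs | P? x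
    ... | no _  = ≤-trans ih (+-monoʳ-≤ (length (filter P? xs)) (m≤n+m _ (g x)))
    ... | yes p = ≤-trans (+-mono-≤ (n≤1+g p) ih) (≤-reflexive (interchange 1 (g x) (length (filter P? xs)) _))

    -- Reconciles two views of the same set: a piece is split off by one combined filter, while the
    -- second moment is counted on the positive points first.
    filter-filter : ∀ {p q} {P : Pred A p} {Q : Pred A q} (P? : Decidable P) (Q? : Decidable Q) xs →
                    filter Q? (filter P? xs) ≡ filter (P? ∩? Q?) xs
    filter-filter P? Q? []       = refl
    filter-filter P? Q? (x ∷ xs) with does (P? x)
    ... | false = filter-filter P? Q? xs
    ... | true with does (Q? x)
    ...   | false = filter-filter P? Q? xs
    ...   | true  = cong (x ∷_) (filter-filter P? Q? xs)

    filter-↭ : ∀ {p} {P : Pred A p} (P? : Decidable P) xs → xs ↭ filter P? xs ++ filter (∁? P?) xs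
    filter-↭ P? xs = subst (λ (ys , zs) → xs ↭ ys ++ zs) (List.partition-defn P? xs)
      (↭ₛ⇒↭ (Permutationₛ.partition-↭ (≡.setoid A) P? xs))

  module _ {a b} {A : Set a} {B : Set b} where

    length-cartesianProduct : ∀ (xs : List A) (ys : List B) →
                              length (cartesianProduct xs ys) ≡ length xs * length ys
    length-cartesianProduct []       ys = refl
    length-cartesianProduct (x ∷ xs) ys = trans (List.length-++ (map (x ,_) ys))
      (cong₂ _+_ (List.length-map (x ,_) ys) (length-cartesianProduct xs ys))

    length-filter-map : ∀ {p} {P : Pred B p} (P? : Decidable P) (f : A → B) xs →
                        length (filter P? (map f xs)) ≡ length (filter (P? ∘ f) xs)
    length-filter-map P? f [] = refl
    length-filter-map P? f (x ∷ xs) with does (P? (f x))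
    ... | false = length-filter-map P? f xs
    ... | true  = cong suc (length-filter-map P? f xs)

  module _ {a b} {A : Set a} {B : Set b} where

    length-filter-cartesianProduct : ∀ {r} {R : Pred (A × B) r} (R? : Decidable R) xs ys →
      length (filter R? (cartesianProduct xs ys)) ≡
      sum (map (λ x → length (filter (λ y → R? (x , y)) ys)) xs)
    length-filter-cartesianProduct R? []       ys = refl
    length-filter-cartesianProduct R? (x ∷ xs) ys = begin
      length (filter R? (map (x ,_) ys ++ cartesianProduct xs ys))
        ≡⟨ cong length (List.filter-++ R? (map (x ,_) ys) _) ⟩
      length (filter R? (map (x ,_) ys) ++ filter R? (cartesianProduct xs ys))
        ≡⟨ List.length-++ (filter R? (map (x ,_) ys)) ⟩
      length (filter R? (map (x ,_) ys)) + length (filter R? (cartesianProduct xs ys))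
        ≡⟨ cong₂ _+_ (length-filter-map R? (x ,_) ys) (length-filter-cartesianProduct R? xs ys) ⟩
      length (filter (λ y → R? (x , y)) ys) + sum (map (λ x → length (filter (λ y → R? (x , y)) ys)) xs)
        ∎
      where open ≡.≡-Reasoning

    -- Both sides count the related pairs, by rows and by columns. A new row `x` raises by one the
    -- column count of exactly those `y` with `R x y`; this is `insert`.
    sum-length-filter-comm : ∀ {r} {R : A → B → Set r} (R? : ∀ x y → Dec (R x y)) xs ys →
      sum (map (λ x → length (filter (R? x) ys)) xs) ≡
      sum (map (λ y → length (filter (λ x → R? x y) xs)) ys)
    sum-length-filter-comm R? []       ys = sym (zeros ys)
      where
      zeros : ∀ (ys : List B) → sum (map (λ _ → 0) ys) ≡ 0
      zeros []       = refl
      zeros (_ ∷ ys) = zeros ys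
    sum-length-filter-comm R? (x ∷ xs) ys =
      trans (cong (length (filter (R? x) ys) +_) (sum-length-filter-comm R? xs ys)) (insert ys)
      where
      count : B → ℕ
      count y = length (filter (λ x → R? x y) xs)
      insert : ∀ ys → length (filter (R? x) ys) + sum (map count ys) ≡
                      sum (map (λ y → length (filter (λ x → R? x y) (x ∷ xs))) ys)
      insert [] = refl
      insert (y ∷ ys) with ih ← cong (count y +_) (insert ys) | does (R? x y)
      ... | true  = cong suc (trans (x∙yz≈y∙xz (length (filter (R? x) ys)) (count y) _) ih)
      ... | false = trans (x∙yz≈y∙xz (length (filter (R? x) ys)) (count y) _) ih

-- Order and arithmetic in the real field.

module OrderedField (𝓡 : RealField) where
  open RealField 𝓡 public
  open CommutativeRing commutativeRing public
    using (+-cong; +-congˡ; +-congʳ; +-assoc; +-comm; +-identityˡ; +-identityʳ; -‿cong; -‿inverseˡ; -‿inverseʳ;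
           *-cong; *-congˡ; *-congʳ; *-assoc; *-comm; *-identityˡ; *-identityʳ; zeroˡ; zeroʳ;
           commutativeSemiring; setoid; +-isCommutativeMonoid)

  strictTotalOrder : StrictTotalOrder _ _ _
  strictTotalOrder = record { isStrictTotalOrder = isStrictTotalOrder }

  open StrictTotalOrder strictTotalOrder public
    using (compare; strictPartialOrder; <-respˡ-≈; <-respʳ-≈; irrefl; module Eq)
  open import Relation.Binary.Properties.StrictTotalOrder strictTotalOrder public
    using (_≤?_) renaming (refl to ≤-refl; trans to ≤-trans)
  open import Relation.Binary.Reasoning.StrictPartialOrder strictPartialOrder public
  open import Algebra.Solver.Ring.NaturalCoefficients.Default commutativeSemiring public
    using (solve; con; _:=_; _:+_; _:*_; _:×_)
  open import Algebra.Properties.Ring (CommutativeRing.ring commutativeRing)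
    using (+-cancelʳ; -‿involutive; -‿distribˡ-*; -‿distribʳ-*)
  open import Algebra.Properties.Semiring.Mult semiring using (×-homo-+; ×1-homo-*)
  open Eq public using () renaming (refl to ≈-refl; sym to ≈-sym; trans to ≈-trans)

  ≮⇒≥ : ∀ {x y} → ¬ (x < y) → y ≤ x
  ≮⇒≥ {x} {y} x≮y with compare x y
  ... | tri< x<y _ _ = contradiction x<y x≮y
  ... | tri≈ _ x≈y _ = inj₂ (≈-sym x≈y)
  ... | tri> _ _ y<x = inj₁ y<x

  ≰⇒> : ∀ {x y} → ¬ (x ≤ y) → y < x
  ≰⇒> {x} {y} x≰y with compare x y
  ... | tri< x<y _ _ = contradiction (inj₁ x<y) x≰y
  ... | tri≈ _ x≈y _ = contradiction (inj₂ x≈y) x≰y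
  ... | tri> _ _ y<x = y<x

  <⇒≱ : ∀ {x y} → x < y → ¬ (y ≤ x)
  <⇒≱ x<y y≤x = irrefl ≈-refl (begin-strict _ <⟨ x<y ⟩ _ ≤⟨ y≤x ⟩ _ ∎)

  +-monoʳ-< : ∀ z {x y} → x < y → z + x < z + y
  +-monoʳ-< z x<y = <-respˡ-≈ (+-comm _ _) (<-respʳ-≈ (+-comm _ _) (+-monoˡ-< z x<y))

  +-mono-≤ : ∀ {x y u v} → x ≤ y → u ≤ v → x + u ≤ y + v
  +-mono-≤ {x} {y} {u} {v} x≤y u≤v = begin
    x + u ≤⟨ left x≤y ⟩
    y + u ≤⟨ right u≤v ⟩
    y + v ∎
    where
    left : x ≤ y → x + u ≤ y + u
    left (inj₁ x<y) = inj₁ (+-monoˡ-< u x<y)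
    left (inj₂ x≈y) = inj₂ (+-congʳ x≈y)
    right : u ≤ v → y + u ≤ y + v
    right (inj₁ u<v) = inj₁ (+-monoʳ-< y u<v)
    right (inj₂ u≈v) = inj₂ (+-congˡ u≈v)

  +-monoˡ-≤ : ∀ z {x y} → x ≤ y → x + z ≤ y + z
  +-monoˡ-≤ z x≤y = +-mono-≤ x≤y ≤-refl

  +-monoʳ-≤ : ∀ z {x y} → x ≤ y → z + x ≤ z + y
  +-monoʳ-≤ z = +-mono-≤ ≤-refl

  +-cancelʳ-< : ∀ z {x y} → x + z < y + z → x < y
  +-cancelʳ-< z x+z<y+z = ≰⇒> λ y≤x → <⇒≱ x+z<y+z (+-monoˡ-≤ z y≤x)

  +-cancelʳ-≈ : ∀ z {x y} → x + z ≈ y + z → x ≈ y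
  +-cancelʳ-≈ z {x} {y} = +-cancelʳ z x y

  x-y+y≈x : ∀ x y → (x - y) + y ≈ x
  x-y+y≈x x y = begin-equality
    (x - y) + y     ≈⟨ +-assoc x (- y) y ⟩
    x + (- y + y)   ≈⟨ +-congˡ (-‿inverseˡ y) ⟩
    x + 0#          ≈⟨ +-identityʳ x ⟩
    x               ∎

  x<y⇒0<y-x : ∀ {x y} → x < y → 0# < y - x
  x<y⇒0<y-x {x} x<y = <-respˡ-≈ (-‿inverseʳ x) (+-monoˡ-< (- x) x<y)

  0≤*0≤ : ∀ {x y} → 0# ≤ x → 0# ≤ y → 0# ≤ x * y
  0≤*0≤ (inj₁ 0<x) (inj₁ 0<y) = inj₁ (*-pos 0<x 0<y)
  0≤*0≤ (inj₁ _) (inj₂ 0≈y) = inj₂ (≈-sym (≈-trans (*-congˡ (≈-sym 0≈y)) (zeroʳ _)))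
  0≤*0≤ (inj₂ 0≈x) _ = inj₂ (≈-sym (≈-trans (*-congʳ (≈-sym 0≈x)) (zeroˡ _)))

  -- Replaces an inequality by an equation with a nonnegative slack, so that polynomial inequalities
  -- become semiring identities in the slack.
  x≤y⇒∃ : ∀ {x y} → x ≤ y → ∃ λ u → (0# ≤ u) × (y ≈ x + u)
  x≤y⇒∃ {x} {y} x≤y = y - x , 0≤y-x x≤y , ≈-sym (≈-trans (+-comm x (y - x)) (x-y+y≈x y x))
    where
    0≤y-x : x ≤ y → 0# ≤ y - x
    0≤y-x (inj₁ x<y) = inj₁ (x<y⇒0<y-x x<y)
    0≤y-x (inj₂ x≈y) = inj₂ (≈-sym (≈-trans (+-congʳ (≈-sym x≈y)) (-‿inverseʳ x)))

  x≤x+y : ∀ x {y} → 0# ≤ y → x ≤ x + y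
  x≤x+y x {y} 0≤y = begin
    x       ≈⟨ +-identityʳ x ⟨
    x + 0#  ≤⟨ +-monoʳ-≤ x 0≤y ⟩
    x + y   ∎

  *-monoʳ-≤ : ∀ {z} → 0# ≤ z → ∀ {x y} → x ≤ y → x * z ≤ y * z
  *-monoʳ-≤ {z} 0≤z {x} {y} x≤y with u , 0≤u , y≈x+u ← x≤y⇒∃ x≤y = begin
    x * z            ≤⟨ x≤x+y (x * z) (0≤*0≤ 0≤u 0≤z) ⟩
    x * z + u * z    ≈⟨ solve 3 (λ x u z → x :* z :+ u :* z := (x :+ u) :* z) ≈-refl x u z ⟩
    (x + u) * z      ≈⟨ *-congʳ y≈x+u ⟨
    y * z            ∎

  *-monoˡ-≤ : ∀ {z} → 0# ≤ z → ∀ {x y} → x ≤ y → z * x ≤ z * y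
  *-monoˡ-≤ {z} 0≤z {x} {y} x≤y = begin
    z * x  ≈⟨ *-comm z x ⟩
    x * z  ≤⟨ *-monoʳ-≤ 0≤z x≤y ⟩
    y * z  ≈⟨ *-comm y z ⟩
    z * y  ∎

  *-monoʳ-< : ∀ {z} → 0# < z → ∀ {x y} → x < y → x * z < y * z
  *-monoʳ-< {z} 0<z {x} {y} x<y = begin-strict
    x * z                  ≈⟨ +-identityʳ (x * z) ⟨
    x * z + 0#             <⟨ +-monoʳ-< (x * z) (*-pos (x<y⇒0<y-x x<y) 0<z) ⟩
    x * z + (y - x) * z    ≈⟨ solve 3 (λ x u z → x :* z :+ u :* z := (u :+ x) :* z) ≈-refl x (y - x) z ⟩
    ((y - x) + x) * z      ≈⟨ *-congʳ (x-y+y≈x y x) ⟩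
    y * z                  ∎

  *-cancelʳ-≤ : ∀ {z} → 0# < z → ∀ {x y} → x * z ≤ y * z → x ≤ y
  *-cancelʳ-≤ 0<z xz≤yz = ≮⇒≥ λ y<x → <⇒≱ (*-monoʳ-< 0<z y<x) xz≤yz

  *-cancelʳ-≈ : ∀ {z} → 0# < z → ∀ {x y} → x * z ≈ y * z → x ≈ y
  *-cancelʳ-≈ 0<z {x} {y} xz≈yz with compare x y
  ... | tri< x<y _ _ = contradiction (*-monoʳ-< 0<z x<y) (irrefl xz≈yz)
  ... | tri≈ _ x≈y _ = x≈y
  ... | tri> _ _ y<x = contradiction (*-monoʳ-< 0<z y<x) (irrefl (≈-sym xz≈yz))

  0<x*y⇒0<x : ∀ {x y} → 0# < y → 0# < x * y → 0# < x
  0<x*y⇒0<x {x} {y} 0<y 0<xy = ≰⇒> λ x≤0 → <⇒≱ 0<xy (begin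
    x * y   ≤⟨ *-monoʳ-≤ (inj₁ 0<y) x≤0 ⟩
    0# * y  ≈⟨ zeroˡ y ⟩
    0#      ∎)

  0≤x*x : ∀ x → 0# ≤ x * x
  0≤x*x x with compare 0# x
  ... | tri< 0<x _ _ = inj₁ (*-pos 0<x 0<x)
  ... | tri≈ _ 0≈x _ = inj₂ (≈-sym (≈-trans (*-congʳ (≈-sym 0≈x)) (zeroˡ x)))
  ... | tri> _ _ x<0 = inj₁ (<-respʳ-≈ [-x][-x]≈xx (*-pos 0<-x 0<-x))
    where
    [-x][-x]≈xx : - x * - x ≈ x * x
    [-x][-x]≈xx = begin-equality
      - x * - x    ≈⟨ -‿distribˡ-* x (- x) ⟨
      - (x * - x)  ≈⟨ -‿cong (-‿distribʳ-* x x) ⟨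
      - - (x * x)  ≈⟨ -‿involutive (x * x) ⟩
      x * x        ∎
    0<-x : 0# < - x
    0<-x = <-respʳ-≈ (+-identityˡ (- x)) (x<y⇒0<y-x x<0)

  -- The two sides differ by the square of `y - x`.
  2xy≤x²+y² : ∀ x y → (x + x) * y ≤ x * x + y * y
  2xy≤x²+y² x y = begin
    (x + x) * y                          ≤⟨ x≤x+y _ (0≤x*x u) ⟩
    (x + x) * y + u * u                  ≈⟨ +-congʳ (*-congˡ y≈) ⟩
    (x + x) * (x + u) + u * u            ≈⟨ solve 2 (λ x u → (x :+ x) :* (x :+ u) :+ u :* u := x :* x :+ (x :+ u) :* (x :+ u)) ≈-refl x u ⟩
    x * x + (x + u) * (x + u)            ≈⟨ +-congˡ (*-cong y≈ y≈) ⟨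
    x * x + y * y                        ∎
    where
    u = y - x
    y≈ : y ≈ x + u
    y≈ = ≈-sym (≈-trans (+-comm x u) (x-y+y≈x y x))

  -- Division and square roots of positive elements.

  x/y*y≈x : ∀ {y} → 0# < y → ∀ x → x / y * y ≈ x
  x/y*y≈x {y} 0<y x = begin-equality
    x * y ⁻¹ * y    ≈⟨ solve 3 (λ x i y → x :* i :* y := x :* (y :* i)) ≈-refl x (y ⁻¹) y ⟩
    x * (y * y ⁻¹)  ≈⟨ *-congˡ (⁻¹-inverse λ y≈0 → irrefl (≈-sym y≈0) 0<y) ⟩
    x * 1#          ≈⟨ *-identityʳ x ⟩
    x               ∎

  x≤z*y⇒x/y≤z : ∀ {x y z} → 0# < y → x ≤ z * y → x / y ≤ z
  x≤z*y⇒x/y≤z {x} {y} {z} 0<y x≤zy = *-cancelʳ-≤ 0<y (begin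
    x / y * y  ≈⟨ x/y*y≈x 0<y x ⟩
    x          ≤⟨ x≤zy ⟩
    z * y      ∎)

  x*y≤z⇒x≤z/y : ∀ {x y z} → 0# < y → x * y ≤ z → x ≤ z / y
  x*y≤z⇒x≤z/y {x} {y} {z} 0<y xy≤z = *-cancelʳ-≤ 0<y (begin
    x * y      ≤⟨ xy≤z ⟩
    z          ≈⟨ x/y*y≈x 0<y z ⟨
    z / y * y  ∎)

  0</ : ∀ {x y} → 0# < x → 0# < y → 0# < x / y
  0</ {x} {y} 0<x 0<y = 0<x*y⇒0<x 0<y (<-respʳ-≈ (≈-sym (x/y*y≈x 0<y x)) 0<x)

  0<x*x⇒0<x : ∀ {x} → 0# ≤ x → 0# < x * x → 0# < x
  0<x*x⇒0<x (inj₁ 0<x) _ = 0<x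
  0<x*x⇒0<x (inj₂ 0≈x) 0<xx = contradiction 0<xx (irrefl (≈-sym (≈-trans (*-congʳ (≈-sym 0≈x)) (zeroˡ _))))

  0<√ : ∀ {x} → 0# < x → 0# < √ x
  0<√ 0<x = 0<x*x⇒0<x (√-nonneg (inj₁ 0<x)) (<-respʳ-≈ (≈-sym (√-square (inj₁ 0<x))) 0<x)

  0<^ : ∀ {x} → 0# < x → ∀ n → 0# < x ^ n
  0<^ 0<x zero = 0<1
  0<^ 0<x (suc n) = *-pos 0<x (0<^ 0<x n)

  -- Natural numbers as reals, and half-integral powers.

  0≤ι : ∀ n → 0# ≤ ι n
  0≤ι zero = ≤-refl
  0≤ι (suc n) = begin
    0#         ≤⟨ 0≤ι n ⟩
    ι n        ≤⟨ x≤x+y (ι n) (inj₁ 0<1) ⟩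
    ι n + 1#   ≈⟨ +-comm (ι n) 1# ⟩
    1# + ι n   ∎

  ι-+ : ∀ m n → ι (m ℕ.+ n) ≈ ι m + ι n
  ι-+ = ×-homo-+ 1#

  ι-* : ∀ m n → ι (m ℕ.* n) ≈ ι m * ι n
  ι-* = ×1-homo-*

  ι-mono-≤ : ∀ {m n} → m ℕ.≤ n → ι m ≤ ι n
  ι-mono-≤ {n = n} ℕ.z≤n = 0≤ι n
  ι-mono-≤ (ℕ.s≤s m≤n) = +-monoʳ-≤ 1# (ι-mono-≤ m≤n)

  0<ι : ∀ {n} → 0 ℕ.< n → 0# < ι n
  0<ι {suc n} _ = begin-strict
    0#         <⟨ 0<1 ⟩
    1#         ≤⟨ x≤x+y 1# (0≤ι n) ⟩
    1# + ι n   ∎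

  -- Undoes the encoding of half-integral powers as powers of a root: the square of `q ^[ n /2]` is
  -- the ordinary power `ι q ^ n`.
  √^-square : ∀ {x} → 0# ≤ x → ∀ n → √ x ^ n * √ x ^ n ≈ x ^ n
  √^-square     0≤x zero    = *-identityˡ 1#
  √^-square {x} 0≤x (suc n) = begin-equality
    √ x * √ x ^ n * (√ x * √ x ^ n)
      ≈⟨ solve 2 (λ r p → r :* p :* (r :* p) := r :* r :* (p :* p)) ≈-refl (√ x) (√ x ^ n) ⟩
    √ x * √ x * (√ x ^ n * √ x ^ n)
      ≈⟨ *-cong (√-square 0≤x) (√^-square 0≤x n) ⟩
    x * x ^ n
      ∎

  -- Finite sums of reals.

  module _ {A : Set} where

    sumOver-mono-≤ : ∀ {f g : A → ℝ} xs → (∀ x → f x ≤ g x) → sumOver f xs ≤ sumOver g xs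
    sumOver-mono-≤ []       f≤g = ≤-refl
    sumOver-mono-≤ (x ∷ xs) f≤g = +-mono-≤ (f≤g x) (sumOver-mono-≤ xs f≤g)

    sumOver-+ : ∀ (f g : A → ℝ) xs → sumOver (λ x → f x + g x) xs ≈ sumOver f xs + sumOver g xs
    sumOver-+ f g []       = ≈-sym (+-identityˡ 0#)
    sumOver-+ f g (x ∷ xs) = ≈-trans (+-congˡ (sumOver-+ f g xs))
      (solve 4 (λ a b c d → (a :+ b) :+ (c :+ d) := (a :+ c) :+ (b :+ d)) ≈-refl (f x) (g x) _ _)

    sumOver-cong : ∀ {f g : A → ℝ} xs → (∀ x → f x ≈ g x) → sumOver f xs ≈ sumOver g xs
    sumOver-cong []       f≈g = ≈-refl
    sumOver-cong (x ∷ xs) f≈g = +-cong (f≈g x) (sumOver-cong xs f≈g)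

    sumOver-*ˡ : ∀ c (f : A → ℝ) xs → sumOver (λ x → c * f x) xs ≈ c * sumOver f xs
    sumOver-*ˡ c f []       = ≈-sym (zeroʳ c)
    sumOver-*ˡ c f (x ∷ xs) = ≈-trans (+-congˡ (sumOver-*ˡ c f xs))
      (solve 3 (λ c a b → c :* a :+ c :* b := c :* (a :+ b)) ≈-refl c (f x) _)

    sumOver-const : ∀ c (xs : List A) → sumOver (λ _ → c) xs ≈ ι (length xs) * c
    sumOver-const c []       = ≈-sym (zeroˡ c)
    sumOver-const c (x ∷ xs) = ≈-trans (+-congˡ (sumOver-const c xs))
      (solve 2 (λ c n → c :+ n :* c := (con 1 :+ n) :* c) ≈-refl c (ι (length xs)))

    sumOver-ι : ∀ (f : A → ℕ) xs → sumOver (ι ∘ f) xs ≈ ι (ℕ.sum (map f xs))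
    sumOver-ι f []       = ≈-refl
    sumOver-ι f (x ∷ xs) = ≈-trans (+-congˡ (sumOver-ι f xs)) (≈-sym (ι-+ (f x) _))

    sumOver-++ : ∀ (f : A → ℝ) xs ys → sumOver f (xs ++ ys) ≈ sumOver f xs + sumOver f ys
    sumOver-++ f []       ys = ≈-sym (+-identityˡ _)
    sumOver-++ f (x ∷ xs) ys = ≈-trans (+-congˡ (sumOver-++ f xs ys)) (≈-sym (+-assoc (f x) _ _))

    sumOver-↭ : ∀ (f : A → ℝ) {xs ys} → xs ↭ ys → sumOver f xs ≈ sumOver f ys
    sumOver-↭ f xs↭ys = Permutationₛ.foldr-commMonoid setoid +-isCommutativeMonoid
      (↭⇒↭ₛ′ Eq.isEquivalence (↭.map⁺ f xs↭ys))

    -- Sums are invariant under permutation and additive under concatenation. The case of the excess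
    -- splits `σ`; the case of the constant one splits the cardinality.
    sumOver-partition : ∀ (f : A → ℝ) {xs T} (R : Fin T → List A) ys →
                        xs ↭ concat (tabulate R) ++ ys →
                        sumOver f xs ≈ sum (λ j → sumOver f (R j)) + sumOver f ys
    sumOver-partition f {xs} {T} R ys xs↭ = begin-equality
      sumOver f xs                                    ≈⟨ sumOver-↭ f xs↭ ⟩
      sumOver f (concat (tabulate R) ++ ys)           ≈⟨ sumOver-++ f (concat (tabulate R)) ys ⟩
      sumOver f (concat (tabulate R)) + sumOver f ys  ≈⟨ +-congʳ (sumOver-concat T R) ⟩
      sum (λ j → sumOver f (R j)) + sumOver f ys      ∎
      where
      sumOver-concat : ∀ T (R : Fin T → List A) →
                       sumOver f (concat (tabulate R)) ≈ sum (λ j → sumOver f (R j))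
      sumOver-concat zero    R = ≈-refl
      sumOver-concat (suc T) R =
        ≈-trans (sumOver-++ f (R zero) _) (+-congˡ (sumOver-concat T (R ∘ suc)))

    sumOver-nonneg : ∀ {f : A → ℝ} xs → (∀ {x} → x ∈ xs → 0# ≤ f x) → 0# ≤ sumOver f xs
    sumOver-nonneg []       0≤f = ≤-refl
    sumOver-nonneg {f} (x ∷ xs) 0≤f = begin
      0#                  ≤⟨ 0≤f (here refl) ⟩
      f x                 ≤⟨ x≤x+y (f x) (sumOver-nonneg xs (0≤f ∘ there)) ⟩
      f x + sumOver f xs  ∎

    sumOver-pos : ∀ {f : A → ℝ} {xs} → xs ≢ [] → (∀ {x} → x ∈ xs → 0# < f x) → 0# < sumOver f xs
    sumOver-pos {xs = []} xs≢[] 0<f = contradiction refl xs≢[]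
    sumOver-pos {f} {x ∷ xs} _  0<f = begin-strict
      0#                  <⟨ 0<f (here refl) ⟩
      f x                 ≤⟨ x≤x+y (f x) (sumOver-nonneg xs (inj₁ ∘ 0<f ∘ there)) ⟩
      f x + sumOver f xs  ∎

    -- By trichotomy, each term dropped by the filter is at most zero.
    sumOver≤sumOver-filter-pos : ∀ (f : A → ℝ) (0<?_ : Decidable (λ x → 0# < f x)) xs →
                                 sumOver f xs ≤ sumOver f (filter 0<?_ xs)
    sumOver≤sumOver-filter-pos f 0<?_ [] = ≤-refl
    sumOver≤sumOver-filter-pos f 0<?_ (x ∷ xs) with ih ← sumOver≤sumOver-filter-pos f 0<?_ xs | 0<? x
    ... | yes _  = +-monoʳ-≤ (f x) ih
    ... | no 0≮f = begin
      f x + sumOver f xs                ≤⟨ +-mono-≤ (≮⇒≥ 0≮f) ih ⟩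
      0# + sumOver f (filter 0<?_ xs)   ≈⟨ +-identityˡ _ ⟩
      sumOver f (filter 0<?_ xs)        ∎

    ι-sum-map-≤ : ∀ {f : A → ℕ} {c} xs → (∀ {x} → x ∈ xs → ι (f x) ≤ c) →
                  ι (ℕ.sum (map f xs)) ≤ ι (length xs) * c
    ι-sum-map-≤ {c = c} [] f≤c = inj₂ (≈-sym (zeroˡ c))
    ι-sum-map-≤ {f} {c} (x ∷ xs) f≤c = begin
      ι (f x ℕ.+ ℕ.sum (map f xs))    ≈⟨ ι-+ (f x) _ ⟩
      ι (f x) + ι (ℕ.sum (map f xs))  ≤⟨ +-mono-≤ (f≤c (here refl)) (ι-sum-map-≤ xs (f≤c ∘ there)) ⟩
      c + ι (length xs) * c           ≈⟨ solve 2 (λ c n → c :+ n :* c := (con 1 :+ n) :* c) ≈-refl c (ι (length xs)) ⟩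
      (1# + ι (length xs)) * c        ∎

  ι-*-≤-sum : ∀ {c} T (f : Fin T → ℝ) → (∀ j → c ≤ f j) → ι T * c ≤ sum f
  ι-*-≤-sum {c} zero    f c≤f = inj₂ (zeroˡ c)
  ι-*-≤-sum {c} (suc T) f c≤f = begin
    (1# + ι T) * c             ≈⟨ solve 2 (λ c n → (con 1 :+ n) :* c := c :+ n :* c) ≈-refl c (ι T) ⟩
    c + ι T * c                ≤⟨ +-mono-≤ (c≤f zero) (ι-*-≤-sum T (f ∘ suc) (c≤f ∘ suc)) ⟩
    f zero + sum (f ∘ suc)     ∎

-- Greedy extraction of pieces from a finite set.

≢[]⇒0<length : ∀ {A : Set} {xs : List A} → xs ≢ [] → 0 ℕ.< length xs
≢[]⇒0<length {xs = []}    xs≢[] = contradiction refl xs≢[]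
≢[]⇒0<length {xs = _ ∷ _} _     = ℕ.z<s

module Extraction {X : Set} (Inv Done Good : Pred (FinSet X) 0ℓ)
  (step : ∀ A → Inv A → Done A ⊎ ∃₂ λ R A′ →
          elements A ↭ elements R ++ elements A′ × Nonempty R × Good R × Inv A′) where

  -- A step either stops or removes a nonempty piece. The remainder then has strictly smaller
  -- cardinality, so well-founded recursion on the cardinality ends, and the permutations of the
  -- single steps compose.
  extract : ∀ A → Inv A →
            ∃[ T ] ∃₂ λ (R : Fin T → FinSet X) B →
              elements A ↭ concat (tabulate (elements ∘ R)) ++ elements B
              × (∀ j → Good (R j)) × Done B
  extract A inv = go A inv (<-wellFounded ∣ A ∣)
    where
    shrinks : ∀ {R : FinSet X} A A′ → elements A ↭ elements R ++ elements A′ → Nonempty R → ∣ A′ ∣ ℕ.< ∣ A ∣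
    shrinks {R} A A′ A↭ R≢∅ = ℕ.<-≤-trans (ℕ.m<n+m ∣ A′ ∣ (≢[]⇒0<length R≢∅))
      (ℕ.≤-reflexive (sym (trans (↭.↭-length A↭) (List.length-++ (elements R)))))
    go : ∀ A → Inv A → Acc ℕ._<_ ∣ A ∣ →
         ∃[ T ] ∃₂ λ (R : Fin T → FinSet X) B →
           elements A ↭ concat (tabulate (elements ∘ R)) ++ elements B
           × (∀ j → Good (R j)) × Done B
    go A inv (acc rs) with step A inv
    ... | inj₁ done = 0 , (λ ()) , A , ↭-refl , (λ ()) , done
    ... | inj₂ (R , A′ , A↭ , R≢∅ , good , inv′)
      with T , Rs , B , A′↭ , goods , done ← go A′ inv′ (rs (shrinks {R} A A′ A↭ R≢∅))
      = suc T , Rs′ , B , A↭′ , goods′ , done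
      where
      Rs′ : Fin (suc T) → FinSet X
      Rs′ zero    = R
      Rs′ (suc j) = Rs j
      A↭′ : elements A ↭ (elements R ++ concat (tabulate (elements ∘ Rs))) ++ elements B
      A↭′ = ↭-trans A↭ (↭-trans (↭.++⁺ˡ (elements R) A′↭)
        (↭-reflexive (sym (List.++-assoc (elements R) _ (elements B)))))
      goods′ : ∀ j → Good (Rs′ j)
      goods′ zero    = good
      goods′ (suc j) = goods j

-- The second moment inequality for real numbers.

module _ (𝓡 : RealField) where
  open OrderedField 𝓡

  -- The last two hypotheses give 8tD ≤ 4D + 5t²n, but with t = 2 + u and
  -- D = tn + v the difference 8tD - (4D + 5t²n) is 2tn + 3utn + 12v + 8uv > 0.
  second-moment-contradiction : ∀ {t n D Y} → 0# < n → 1# + 1# ≤ t → t * n ≤ D →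
    (t + t) * D ≤ (D + Y) + t * t * n → ι 4 * Y ≤ t * t * n → ⊥
  second-moment-contradiction {t} {n} {D} {Y} 0<n 2≤t tn≤D 2tD≤ 4Y≤
    with u , 0≤u , t≈ ← x≤y⇒∃ 2≤t | v , 0≤v , D≈ ← x≤y⇒∃ tn≤D
    = <⇒≱ lower upper
    where
    t′ D′ gap : ℝ
    t′  = (1# + 1#) + u
    D′  = t′ * n + v
    gap = ι 2 * (t′ * n) + (ι 3 * (u * (t′ * n)) + (ι 12 * v + ι 8 * (u * v)))
    D≈D′ : D ≈ D′
    D≈D′ = ≈-trans D≈ (+-congʳ (*-congʳ t≈))
    0<t′n : 0# < t′ * n
    0<t′n = *-pos (begin-strict
      0#        <⟨ 0<1 ⟩
      1#        ≤⟨ x≤x+y 1# (inj₁ 0<1) ⟩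
      1# + 1#   ≤⟨ x≤x+y _ 0≤u ⟩
      t′        ∎) 0<n
    0<gap : 0# < gap
    0<gap = begin-strict
      0#                <⟨ *-pos (0<ι {2} ℕ.z<s) 0<t′n ⟩
      ι 2 * (t′ * n)    ≤⟨ x≤x+y _ (begin
        0#        ≈⟨ +-identityˡ 0# ⟨
        0# + 0#   ≤⟨ +-mono-≤ (0≤*0≤ (0≤ι 3) (0≤*0≤ 0≤u (inj₁ 0<t′n)))
                       (≤-trans (0≤*0≤ (0≤ι 12) 0≤v) (x≤x+y _ (0≤*0≤ (0≤ι 8) (0≤*0≤ 0≤u 0≤v)))) ⟩
        ι 3 * (u * (t′ * n)) + (ι 12 * v + ι 8 * (u * v)) ∎) ⟩
      gap               ∎
    rhs : ℝ
    rhs = ι 4 * D′ + ι 5 * (t′ * t′ * n)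
    lower : rhs < ι 4 * ((t′ + t′) * D′)
    lower = begin-strict
      rhs                     ≈⟨ +-identityʳ rhs ⟨
      rhs + 0#                <⟨ +-monoʳ-< rhs 0<gap ⟩
      rhs + gap               ≈⟨ solve 3 (λ u v n →
                                   let t = (con 1 :+ con 1) :+ u; D = t :* n :+ v in
                                   (4 :× con 1) :* D :+ (5 :× con 1) :* (t :* t :* n)
                                   :+ ((2 :× con 1) :* (t :* n) :+ ((3 :× con 1) :* (u :* (t :* n))
                                       :+ ((12 :× con 1) :* v :+ (8 :× con 1) :* (u :* v))))
                                   := (4 :× con 1) :* ((t :+ t) :* D)) ≈-refl u v n ⟩
      ι 4 * ((t′ + t′) * D′)  ∎
    upper : ι 4 * ((t′ + t′) * D′) ≤ rhs
    upper = begin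
      ι 4 * ((t′ + t′) * D′)                        ≈⟨ *-congˡ (*-cong (+-cong t≈ t≈) D≈D′) ⟨
      ι 4 * ((t + t) * D)                           ≤⟨ *-monoˡ-≤ (0≤ι 4) 2tD≤ ⟩
      ι 4 * ((D + Y) + t * t * n)
        ≈⟨ solve 3 (λ D Y w → (4 :× con 1) :* ((D :+ Y) :+ w)
                              := ((4 :× con 1) :* D :+ (4 :× con 1) :* w) :+ (4 :× con 1) :* Y)
                   ≈-refl D Y (t * t * n) ⟩
      (ι 4 * D + ι 4 * (t * t * n)) + ι 4 * Y       ≤⟨ +-monoʳ-≤ _ 4Y≤ ⟩
      (ι 4 * D + ι 4 * (t * t * n)) + t * t * n
        ≈⟨ solve 2 (λ D w → ((4 :× con 1) :* D :+ (4 :× con 1) :* w) :+ w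
                            := (4 :× con 1) :* D :+ (5 :× con 1) :* w) ≈-refl D (t * t * n) ⟩
      ι 4 * D + ι 5 * (t * t * n)                   ≈⟨ +-cong (*-congˡ D≈D′) (*-congˡ (*-congʳ (*-cong t≈ t≈))) ⟩
      rhs                                           ∎

  -- Degrees, excess and pairs of spheres through a point.

  module _ {q : ℕ} (𝔽 : FiniteField q) {d : ℕ} (Q : QuadraticForm 𝔽 d) (0<q : 0 ℕ.< q)
           (𝓢 : FinSet (Sphere 𝔽 d)) where
    open Incidence 𝓡 𝔽 Q
    open Counting

    SpherePair : Set
    SpherePair = Sphere 𝔽 d × Sphere 𝔽 d

    spherePairs : List SpherePair
    spherePairs = cartesianProduct (elements 𝓢) (elements 𝓢)

    -- Nonconcentricity is part of the condition on the point. Sums can thus run over all ordered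
    -- pairs, a concentric pair contributing nothing, and a single point satisfying the condition
    -- certifies that its pair is nonconcentric.
    InNonconcentric : SpherePair → Pred (Point 𝔽 d) 0ℓ
    InNonconcentric (S , S′) p = (p ∈ˢ S × p ∈ˢ S′) × Nonconcentric S S′

    concentric? : ∀ (S S′ : Sphere 𝔽 d) → Dec (proj₁ S ≡ proj₁ S′)
    concentric? S S′ = Vec.≡-dec (FiniteField._≟_ 𝔽) (proj₁ S) (proj₁ S′)

    inNonconcentric? : ∀ π → Decidable (InNonconcentric π)
    inNonconcentric? (S , S′) p = ((p ∈ˢ? S) ×-dec (p ∈ˢ? S′)) ×-dec ¬? (concentric? S S′)

    positive? : Decidable (λ p → 0# < excess 𝓢 p)
    positive? p with compare 0# (excess 𝓢 p)
    ... | tri< 0<e _ _ = yes 0<e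
    ... | tri≈ 0≮e _ _ = no 0≮e
    ... | tri> 0≮e _ _ = no 0≮e

    -- Concentric spheres through a common point coincide, so the degree
    -- squared counts each sphere through p with itself and otherwise only
    -- nonconcentric pairs.
    degree²≤ : ∀ p → degree 𝓢 p ℕ.* degree 𝓢 p ℕ.≤
                     degree 𝓢 p ℕ.+ length (filter (λ π → inNonconcentric? π p) spherePairs)
    degree²≤ p = subst (λ k → degree 𝓢 p ℕ.* degree 𝓢 p ℕ.≤ degree 𝓢 p ℕ.+ k)
      (sym (length-filter-cartesianProduct (λ π → inNonconcentric? π p) (elements 𝓢) (elements 𝓢)))
      (*-length-filter-≤ (p ∈ˢ?_) (λ {S} p∈S → ℕ.≤-trans
        (length-filter-⊎ (p ∈ˢ?_) (concentric∋? S) (λ S′ → inNonconcentric? (S , S′) p)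
          (split p∈S) (elements 𝓢))
        (ℕ.+-monoˡ-≤ _ (length-filter-unique (concentric∋? S) (unique 𝓢) λ _ _ → same))) (elements 𝓢))
      where
      concentric∋? : ∀ S → Decidable (λ S′ → p ∈ˢ S′ × proj₁ S ≡ proj₁ S′)
      concentric∋? S S′ = (p ∈ˢ? S′) ×-dec concentric? S S′
      split : ∀ {S S′} → p ∈ˢ S → p ∈ˢ S′ →
              (p ∈ˢ S′ × proj₁ S ≡ proj₁ S′) ⊎ InNonconcentric (S , S′) p
      split {S} {S′} p∈S p∈S′ with concentric? S S′
      ... | yes c≡c′ = inj₁ (p∈S′ , c≡c′)
      ... | no c≢c′  = inj₂ ((p∈S , p∈S′) , c≢c′)
      -- Both radii are the value of `form` at `p` minus the common centre, so the parameter pairs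
      -- agree.
      same : ∀ {c S S′} → p ∈ˢ S × c ≡ proj₁ S → p ∈ˢ S′ × c ≡ proj₁ S′ → S ≡ S′
      same (refl , refl) (refl , refl) = refl

    -- Sum the pointwise bound over `B` and exchange the order of summation: counting pairs at each
    -- point becomes counting points of `B` for each pair.
    sum-degree²≤ : ∀ (B : List (Point 𝔽 d)) →
      ℕ.sum (map (λ p → degree 𝓢 p ℕ.* degree 𝓢 p) B) ℕ.≤
      ℕ.sum (map (degree 𝓢) B) ℕ.+ ℕ.sum (map (λ π → length (filter (inNonconcentric? π) B)) spherePairs)
    sum-degree²≤ B = ℕ.≤-trans (sum-map-mono-≤ B (λ {p} _ → degree²≤ p))
      (ℕ.≤-reflexive (trans (sum-map-+ (degree 𝓢) _ B)
        (cong (ℕ.sum (map (degree 𝓢) B) ℕ.+_)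
          (sum-length-filter-comm (λ p π → inNonconcentric? π p) B spherePairs))))

    excess+ : ∀ p → excess 𝓢 p + ι ∣ 𝓢 ∣ / ι q ≈ ι (degree 𝓢 p)
    excess+ p = x-y+y≈x _ _

    excess≤degree : ∀ p → excess 𝓢 p ≤ ι (degree 𝓢 p)
    excess≤degree p = begin
      excess 𝓢 p                     ≤⟨ x≤x+y _ 0≤|S|/q ⟩
      excess 𝓢 p + ι ∣ 𝓢 ∣ / ι q     ≈⟨ excess+ p ⟩
      ι (degree 𝓢 p)                 ∎
      where
      0≤|S|/q : 0# ≤ ι ∣ 𝓢 ∣ / ι q
      0≤|S|/q = x*y≤z⇒x≤z/y (0<ι 0<q) (begin
        0# * ι q  ≈⟨ zeroˡ _ ⟩
        0#        ≤⟨ 0≤ι ∣ 𝓢 ∣ ⟩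
        ι ∣ 𝓢 ∣   ∎)

    -- Adding the cardinality of `P` times the mean degree `ι ∣ 𝓢 ∣ / ι q` turns either side into
    -- the number of incidences, counted over pairs on the left and point by point on the right.
    σ≈sumOver-excess : ∀ P → σ P 𝓢 ≈ σ[ 𝓢 ] P
    σ≈sumOver-excess P = +-cancelʳ-≈ (ι ∣ P ∣ * (ι ∣ 𝓢 ∣ / ι q)) (begin-equality
      σ P 𝓢 + ι ∣ P ∣ * c
        ≈⟨ +-congˡ (*-assoc (ι ∣ P ∣) (ι ∣ 𝓢 ∣) (ι q ⁻¹)) ⟨
      σ P 𝓢 + (ι ∣ P ∣ * ι ∣ 𝓢 ∣) / ι q
        ≈⟨ x-y+y≈x _ _ ⟩
      ι (incidences P 𝓢)
        ≡⟨ cong ι (length-filter-cartesianProduct (λ pS → proj₁ pS ∈ˢ? proj₂ pS) (elements P) (elements 𝓢)) ⟩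
      ι (ℕ.sum (map (degree 𝓢) (elements P)))
        ≈⟨ sumOver-ι (degree 𝓢) (elements P) ⟨
      sumOver (ι ∘ degree 𝓢) (elements P)
        ≈⟨ sumOver-cong (elements P) excess+ ⟨
      sumOver (λ p → excess 𝓢 p + c) (elements P)
        ≈⟨ sumOver-+ (excess 𝓢) (λ _ → c) (elements P) ⟩
      σ[ 𝓢 ] P + sumOver (λ _ → c) (elements P)
        ≈⟨ +-congˡ (sumOver-const c (elements P)) ⟩
      σ[ 𝓢 ] P + ι ∣ P ∣ * c
        ∎)
      where
      c : ℝ
      c = ι ∣ 𝓢 ∣ / ι q

    -- A finite search: the order is decidable, and if every pair falls short of `m`, the second
    -- moment is too small. The number `n` only bounds the length of `A`, because `A` shrinks during
    -- the extraction while the threshold stays tied to the size of the original set.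
    rich-pair : ∀ {t m n} (A : List (Point 𝔽 d)) → 0 ℕ.< n → length A ℕ.≤ n →
                1# + 1# ≤ t → t * ι n ≤ sumOver (excess 𝓢) A →
                ι 4 * (ι ∣ 𝓢 ∣ * ι ∣ 𝓢 ∣ * m) ≤ t * t * ι n →
                ∃[ π ] π ∈ spherePairs × m ≤ ι (length (filter (positive? ∩? inNonconcentric? π) A))
    rich-pair {t} {m} {n} A 0<n |A|≤n 2≤t tn≤ 4MMm≤
      with any? (λ π → m ≤? ι (length (filter (positive? ∩? inNonconcentric? π) A))) spherePairs
    ... | yes rich = find rich
    ... | no ¬rich = contradiction 4Y≤ (second-moment-contradiction (0<ι 0<n) 2≤t tn≤D 2tD≤)
      where
      B : List (Point 𝔽 d)
      B = filter positive? A
      D Y : ℕ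
      D = ℕ.sum (map (degree 𝓢) B)
      Y = ℕ.sum (map (λ π → length (filter (inNonconcentric? π) B)) spherePairs)
      tn≤D : t * ι n ≤ ι D
      tn≤D = begin
        t * ι n                     ≤⟨ tn≤ ⟩
        sumOver (excess 𝓢) A        ≤⟨ sumOver≤sumOver-filter-pos (excess 𝓢) positive? A ⟩
        sumOver (excess 𝓢) B        ≤⟨ sumOver-mono-≤ B excess≤degree ⟩
        sumOver (ι ∘ degree 𝓢) B    ≈⟨ sumOver-ι (degree 𝓢) B ⟩
        ι D                         ∎
      2tD≤ : (t + t) * ι D ≤ (ι D + ι Y) + t * t * ι n
      2tD≤ = begin
        (t + t) * ι D
          ≈⟨ *-congˡ (sumOver-ι (degree 𝓢) B) ⟨
        (t + t) * sumOver (ι ∘ degree 𝓢) B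
          ≈⟨ sumOver-*ˡ (t + t) (ι ∘ degree 𝓢) B ⟨
        sumOver (λ p → (t + t) * ι (degree 𝓢 p)) B
          ≤⟨ sumOver-mono-≤ B (λ p → 2xy≤x²+y² t (ι (degree 𝓢 p))) ⟩
        sumOver (λ p → t * t + ι (degree 𝓢 p) * ι (degree 𝓢 p)) B
          ≈⟨ sumOver-+ (λ _ → t * t) _ B ⟩
        sumOver (λ _ → t * t) B + sumOver (λ p → ι (degree 𝓢 p) * ι (degree 𝓢 p)) B
          ≈⟨ +-cong (sumOver-const (t * t) B)
               (sumOver-cong B λ p → ≈-sym (ι-* (degree 𝓢 p) (degree 𝓢 p))) ⟩
        ι (length B) * (t * t) + sumOver (λ p → ι (degree 𝓢 p ℕ.* degree 𝓢 p)) B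
          -- Since `t * t` is nonnegative, the length of `B` may be enlarged to `n`.
          ≤⟨ +-mono-≤ (*-monoʳ-≤ (0≤x*x t) (ι-mono-≤ (ℕ.≤-trans (List.length-filter positive? A) |A|≤n)))
               (begin
                 sumOver (λ p → ι (degree 𝓢 p ℕ.* degree 𝓢 p)) B
                   ≈⟨ sumOver-ι (λ p → degree 𝓢 p ℕ.* degree 𝓢 p) B ⟩
                 ι (ℕ.sum (map (λ p → degree 𝓢 p ℕ.* degree 𝓢 p) B))
                   ≤⟨ ι-mono-≤ (sum-degree²≤ B) ⟩
                 ι (D ℕ.+ Y)
                   ≈⟨ ι-+ D Y ⟩
                 ι D + ι Y
                   ∎) ⟩
        ι n * (t * t) + (ι D + ι Y)
          ≈⟨ solve 3 (λ n w z → n :* w :+ z := z :+ w :* n) ≈-refl (ι n) (t * t) (ι D + ι Y) ⟩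
        (ι D + ι Y) + t * t * ι n
          ∎
      poor : ∀ {π} → π ∈ spherePairs → ι (length (filter (inNonconcentric? π) B)) ≤ m
      poor {π} π∈ = inj₁ (≰⇒> λ m≤ → ¬rich (lose π∈
        (subst (λ xs → m ≤ ι (length xs)) (filter-filter positive? (inNonconcentric? π) A) m≤)))
      4Y≤ : ι 4 * ι Y ≤ t * t * ι n
      4Y≤ = begin
        ι 4 * ι Y                                      ≤⟨ *-monoˡ-≤ (0≤ι 4) (ι-sum-map-≤ spherePairs poor) ⟩
        ι 4 * (ι (length spherePairs) * m)
          ≡⟨ cong (λ k → ι 4 * (ι k * m)) (length-cartesianProduct (elements 𝓢) (elements 𝓢)) ⟩
        ι 4 * (ι (∣ 𝓢 ∣ ℕ.* ∣ 𝓢 ∣) * m)                ≈⟨ *-congˡ (*-congʳ (ι-* ∣ 𝓢 ∣ ∣ 𝓢 ∣)) ⟩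
        ι 4 * (ι ∣ 𝓢 ∣ * ι ∣ 𝓢 ∣ * m)                  ≤⟨ 4MMm≤ ⟩
        t * t * ι n                                    ∎

    -- Rich pieces and the partition into them.

    Rich : FinSet (Point 𝔽 d) → ℝ → Pred (FinSet (Point 𝔽 d)) 0ℓ
    Rich P m R = Σ[ S ∈ Sphere 𝔽 d ] Σ[ S′ ∈ Sphere 𝔽 d ]
      S ∈ elements 𝓢 × S′ ∈ elements 𝓢 × Nonconcentric S S′
      × (∀ {p} → p ∈ elements R → Pos 𝓢 P p × p ∈ˢ S × p ∈ˢ S′)
      × m ≤ ι ∣ R ∣

    0<ι∣∣⇒Nonempty : ∀ (R : FinSet (Point 𝔽 d)) → 0# < ι ∣ R ∣ → Nonempty R
    0<ι∣∣⇒Nonempty R 0<|R| R≡[] = irrefl (≡.subst (λ xs → 0# ≈ ι (length xs)) (sym R≡[]) ≈-refl) 0<|R|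

    -- Having at least `m > 0` points, the piece is nonempty, and each of its points has positive
    -- excess.
    σ-Rich-pos : ∀ {P m} → 0# < m → ∀ R → Rich P m R → 0# < σ[ 𝓢 ] R
    σ-Rich-pos 0<m R (_ , _ , _ , _ , _ , R⊆ , m≤|R|) =
      sumOver-pos (0<ι∣∣⇒Nonempty R (begin-strict _ <⟨ 0<m ⟩ _ ≤⟨ m≤|R| ⟩ _ ∎))
        (λ p∈R → proj₂ (proj₁ (R⊆ p∈R)))

    -- Extraction stops once the remainder has `σ` below `θ`. Until then `t * ι ∣ P ∣ ≤ θ` supplies
    -- the lower bound that `rich-pair` asks for, with `n` the size of the whole `P`.
    rich-partition : ∀ {t m θ} (P : FinSet (Point 𝔽 d)) → 0 ℕ.< ∣ P ∣ → 0# < m →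
      1# + 1# ≤ t → t * ι ∣ P ∣ ≤ θ → ι 4 * (ι ∣ 𝓢 ∣ * ι ∣ 𝓢 ∣ * m) ≤ t * t * ι ∣ P ∣ →
      ∃[ T ] ∃₂ λ (R : Fin T → FinSet (Point 𝔽 d)) B →
        elements P ↭ concat (tabulate (elements ∘ R)) ++ elements B
        × (∀ j → Rich P m (R j)) × σ[ 𝓢 ] B < θ
    rich-partition {t} {m} {θ} P 0<|P| 0<m 2≤t tN≤θ 4MMm≤ =
      Extraction.extract Inv (λ A → σ[ 𝓢 ] A < θ) (Rich P m) step P ((λ p∈P → p∈P) , ℕ.≤-refl)
      where
      -- The cardinality bound is carried along with the inclusion instead of being deduced from it.
      Inv : Pred (FinSet (Point 𝔽 d)) 0ℓ
      Inv A = (∀ {p} → p ∈ elements A → p ∈ elements P) × ∣ A ∣ ℕ.≤ ∣ P ∣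
      filterSet : ∀ {ψ : Pred (Point 𝔽 d) 0ℓ} → Decidable ψ → FinSet (Point 𝔽 d) → FinSet (Point 𝔽 d)
      filterSet ψ? A = record
        { elements = filter ψ? (elements A) ; unique = Unique.filter⁺ ψ? (unique A) }
      step : ∀ A → Inv A → σ[ 𝓢 ] A < θ ⊎ ∃₂ λ R A′ →
             elements A ↭ elements R ++ elements A′ × Nonempty R × Rich P m R × Inv A′
      step A (A⊆P , |A|≤|P|) with θ ≤? σ[ 𝓢 ] A
      ... | no θ≰  = inj₁ (≰⇒> θ≰)
      ... | yes θ≤ with (S , S′) , π∈ , m≤ ← rich-pair (elements A) 0<|P| |A|≤|P| 2≤t (≤-trans tN≤θ θ≤) 4MMm≤
        = inj₂ (R , A′ , filter-↭ ψ? (elements A) , R≢∅ , rich , inv′)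
        where
        ψ? = positive? ∩? inNonconcentric? (S , S′)
        R A′ : FinSet (Point 𝔽 d)
        R  = filterSet ψ? A
        A′ = filterSet (∁? ψ?) A
        R≢∅ : Nonempty R
        R≢∅ = 0<ι∣∣⇒Nonempty R (begin-strict _ <⟨ 0<m ⟩ _ ≤⟨ m≤ ⟩ _ ∎)
        -- Any point of the nonempty set `R` carries the proof, because the filter predicate
        -- includes nonconcentricity.
        S≁S′ : Nonconcentric S S′
        S≁S′ with elements R | R≢∅ | (λ {p} → ∈-filter⁻ ψ? {p} {elements A})
        ... | []    | []≢[] | _  = contradiction refl []≢[]
        ... | p ∷ _ | _     | R⊆ = proj₂ (proj₂ (proj₂ (R⊆ (here refl))))
        rich : Rich P m R
        rich = S , S′ , proj₁ S,S′∈ , proj₂ S,S′∈ , S≁S′ ,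
          (λ p∈R → let p∈A , 0<e , p∈S∩S′ , _ = ∈-filter⁻ ψ? p∈R in (A⊆P p∈A , 0<e) , p∈S∩S′) , m≤
          where
          S,S′∈ : S ∈ elements 𝓢 × S′ ∈ elements 𝓢
          S,S′∈ = ∈-cartesianProduct⁻ (elements 𝓢) (elements 𝓢) π∈
        inv′ : Inv A′
        inv′ = (A⊆P ∘ proj₁ ∘ ∈-filter⁻ (∁? ψ?))
             , ℕ.≤-trans (List.length-filter (∁? ψ?) (elements A)) |A|≤|P|

-- Choice of constants and the four properties of the partition.

oddPrimePower⇒0< : ∀ {q} → OddPrimePower q → 0 ℕ.< q
oddPrimePower⇒0< {zero}  (_ , 2∤0) = contradiction (_ ∣0) 2∤0
oddPrimePower⇒0< {suc _} _         = ℕ.z<s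

theorem3p9 :
  (𝓡 : RealField) (let open RealField 𝓡)
  (q : ℕ) → OddPrimePower q →
  (𝔽 : FiniteField q) →
  (d : ℕ) → 2 ℕ.≤ d →
  (Q : QuadraticForm 𝔽 d) → QuadraticForm.Nondegenerate Q →
  (let open Incidence 𝓡 𝔽 Q) →
  (P : FinSet (Point 𝔽 d)) → Nonempty P →
  (𝓢 : FinSet (Sphere 𝔽 d)) → Nonempty 𝓢 →
  (K : ℝ) → 0# < K →
  K * q ^[ d ∸ 1 /2] * √ (ι ∣ P ∣ * ι ∣ 𝓢 ∣) ≤ σ P 𝓢 →
  (ε : ℝ) → 0# < ε → ε ≤ 1# →
  ι 4 * ι ∣ P ∣ ≤ ε ^ 2 * K ^ 2 * ι q ^ (d ∸ 1) * ι ∣ 𝓢 ∣ →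
  Σ[ T ∈ ℕ ] Σ[ R ∈ (Fin T → FinSet (Point 𝔽 d)) ] Σ[ Prem ∈ FinSet (Point 𝔽 d) ]
    -- P is the disjoint union of the pieces R j and Prem
    (elements P ↭ concat (tabulate (λ j → elements (R j))) ++ elements Prem)
    × (∀ (j : Fin T) → Σ[ S ∈ Sphere 𝔽 d ] Σ[ S′ ∈ Sphere 𝔽 d ]
          S ∈ elements 𝓢 × S′ ∈ elements 𝓢 × Nonconcentric S S′
          × (∀ {p} → p ∈ elements (R j) → Pos 𝓢 P p × p ∈ˢ S × p ∈ˢ S′)
          × (ε ^ 2 * K ^ 2 * ι q ^ (d ∸ 1)) / (ι 4 * ι ∣ 𝓢 ∣) ≤ ι ∣ R j ∣)
    × (∀ (j : Fin T) → 0# < σ[ 𝓢 ] (R j))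
    × ι T ≤ (ι 4 * ι ∣ P ∣ * ι ∣ 𝓢 ∣) / (ε ^ 2 * K ^ 2 * ι q ^ (d ∸ 1))
    × σ[ 𝓢 ] Prem < ε * σ P 𝓢
    × (1# - ε) * σ P 𝓢 < sum (λ j → σ[ 𝓢 ] (R j))
    × (∀ (C₁ : ℝ) → ι ∣ 𝓢 ∣ ≤ C₁ * K * q ^[ d ∸ 1 /2] →
        ∀ (j : Fin T) → (ε ^ 2 * K * q ^[ d ∸ 1 /2]) / (ι 4 * C₁) ≤ ι ∣ R j ∣)
theorem3p9 𝓡 q q-odd 𝔽 d _ Q _ P P≢∅ 𝓢 𝓢≢∅ K 0<K σ-large ε 0<ε _ 𝓢-large =
  let T , R , Prem , P↭ , rich , σPrem< = rich-partition 𝓡 𝔽 Q 0<q 𝓢 P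
        (≢[]⇒0<length P≢∅) 0<m 2≤t tN≤εσ 4MMm≤ttN
  in T , R , Prem , P↭ , rich
  , (λ j → σ-Rich-pos 𝓡 𝔽 Q 0<q 𝓢 {P} 0<m (R j) (rich j))
  , T≤ T R Prem P↭ rich , σPrem< , σR> T R Prem P↭ σPrem< , λ C₁ M≤ j → size C₁ M≤ (R j) (rich j)
  where
  open OrderedField 𝓡
  open Incidence 𝓡 𝔽 Q
  N M h s L t m : ℝ
  N = ι ∣ P ∣
  M = ι ∣ 𝓢 ∣
  h = q ^[ d ∸ 1 /2]
  s = √ (N * M)
  L = ε ^ 2 * K ^ 2 * ι q ^ (d ∸ 1)
  t = ε * K * h * s / N
  m = L / (ι 4 * M)

  0<q : 0 ℕ.< q
  0<q = oddPrimePower⇒0< q-odd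
  0<N : 0# < N
  0<N = 0<ι (≢[]⇒0<length P≢∅)
  0<M : 0# < M
  0<M = 0<ι (≢[]⇒0<length 𝓢≢∅)
  0<h : 0# < h
  0<h = 0<^ (0<√ (0<ι 0<q)) (d ∸ 1)
  0<s : 0# < s
  0<s = 0<√ (*-pos 0<N 0<M)
  0<L : 0# < L
  0<L = *-pos (*-pos (0<^ 0<ε 2) (0<^ 0<K 2)) (0<^ (0<ι 0<q) (d ∸ 1))
  0<4M : 0# < ι 4 * M
  0<4M = *-pos (0<ι {4} ℕ.z<s) 0<M
  0<m : 0# < m
  0<m = 0</ 0<L 0<4M
  0<εKhs : 0# < ε * K * h * s
  0<εKhs = *-pos (*-pos (*-pos 0<ε 0<K) 0<h) 0<s

  tN≈ : t * N ≈ ε * K * h * s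
  tN≈ = x/y*y≈x 0<N _

  -- After multiplication by a further `N` the left side is the square of `t * N`, that is of
  -- `ε * K * h * s`; here `h * h` is `ι q ^ (d ∸ 1)` and `s * s` is `N * M`.
  ttN≈LM : t * t * N ≈ L * M
  ttN≈LM = *-cancelʳ-≈ 0<N (begin-equality
    t * t * N * N
      ≈⟨ solve 2 (λ t n → t :* t :* n :* n := (t :* n) :* (t :* n)) ≈-refl t N ⟩
    (t * N) * (t * N)
      ≈⟨ *-cong tN≈ tN≈ ⟩
    (ε * K * h * s) * (ε * K * h * s)
      -- The factors `con 1` match the unfolding of `x ^ 2` to `x * (x * 1#)`.
      ≈⟨ solve 4 (λ e k h s → (e :* k :* h :* s) :* (e :* k :* h :* s) :=
           (e :* (e :* con 1)) :* (k :* (k :* con 1)) :* (h :* h) :* (s :* s)) ≈-refl ε K h s ⟩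
    ε ^ 2 * K ^ 2 * (h * h) * (s * s)
      ≈⟨ *-cong (*-congˡ (√^-square (0≤ι q) (d ∸ 1))) (√-square (inj₁ (*-pos 0<N 0<M))) ⟩
    L * (N * M)
      ≈⟨ solve 3 (λ l n m → l :* (n :* m) := l :* m :* n) ≈-refl L N M ⟩
    L * M * N
      ∎)

  -- If `t` were below two, `t * t * N` would be below `ι 4 * N`, against the size hypothesis read
  -- through `ttN≈LM`.
  2≤t : 1# + 1# ≤ t
  2≤t = ≮⇒≥ λ t<2 → <⇒≱ (*-monoʳ-< 0<N (begin-strict
      t * t                      <⟨ *-monoʳ-< (0</ 0<εKhs 0<N) t<2 ⟩
      (1# + 1#) * t              ≤⟨ *-monoˡ-≤ 0≤2 (inj₁ t<2) ⟩
      (1# + 1#) * (1# + 1#)      ≈⟨ solve 0 ((con 1 :+ con 1) :* (con 1 :+ con 1) := 4 :× con 1) ≈-refl ⟩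
      ι 4                        ∎))
    (begin
      ι 4 * N    ≤⟨ 𝓢-large ⟩
      L * M      ≈⟨ ttN≈LM ⟨
      t * t * N  ∎)
    where
    0≤2 : 0# ≤ 1# + 1#
    0≤2 = ≤-trans (inj₁ 0<1) (x≤x+y 1# (inj₁ 0<1))

  tN≤εσ : t * N ≤ ε * σ P 𝓢
  tN≤εσ = begin
    t * N              ≈⟨ tN≈ ⟩
    ε * K * h * s      ≈⟨ solve 4 (λ e k h s → e :* k :* h :* s := e :* (k :* h :* s)) ≈-refl ε K h s ⟩
    ε * (K * h * s)    ≤⟨ *-monoˡ-≤ (inj₁ 0<ε) σ-large ⟩
    ε * σ P 𝓢          ∎

  m4M≈L : m * (ι 4 * M) ≈ L
  m4M≈L = x/y*y≈x 0<4M L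

  -- Equality holds by the choice of `m`, as `m * (ι 4 * M)` is `L`.
  4MMm≤ttN : ι 4 * (M * M * m) ≤ t * t * N
  4MMm≤ttN = inj₂ (begin-equality
    ι 4 * (M * M * m)
      ≈⟨ solve 3 (λ f M m → f :* (M :* M :* m) := (m :* (f :* M)) :* M) ≈-refl (ι 4) M m ⟩
    m * (ι 4 * M) * M
      ≈⟨ *-congʳ m4M≈L ⟩
    L * M
      ≈⟨ ttN≈LM ⟨
    t * t * N
      ∎)

  module _ (T : ℕ) (R : Fin T → FinSet (Point 𝔽 d)) (Prem : FinSet (Point 𝔽 d))
           (P↭ : elements P ↭ concat (tabulate (elements ∘ R)) ++ elements Prem) where

    -- Disjoint pieces of at least `m` points each fit into `P`, so `ι T * m ≤ N`. Cardinalities are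
    -- written as sums of ones so that the partition formula applies.
    T≤ : (∀ j → Rich 𝓡 𝔽 Q 0<q 𝓢 P m (R j)) → ι T ≤ (ι 4 * N * M) / L
    T≤ rich = x*y≤z⇒x≤z/y 0<L (begin
      ι T * L                  ≈⟨ *-congˡ m4M≈L ⟨
      ι T * (m * (ι 4 * M))    ≈⟨ *-assoc (ι T) m (ι 4 * M) ⟨
      ι T * m * (ι 4 * M)      ≤⟨ *-monoʳ-≤ (inj₁ 0<4M) Tm≤N ⟩
      N * (ι 4 * M)            ≈⟨ solve 3 (λ n f m → n :* (f :* m) := f :* n :* m) ≈-refl N (ι 4) M ⟩
      ι 4 * N * M              ∎)
      where
      ι-length : ∀ (xs : List (Point 𝔽 d)) → sumOver (λ _ → 1#) xs ≈ ι (length xs)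
      ι-length xs = ≈-trans (sumOver-const 1# xs) (*-identityʳ _)
      Tm≤N : ι T * m ≤ N
      Tm≤N = begin
        ι T * m
          ≤⟨ ι-*-≤-sum T _ (λ j → let _ , _ , _ , _ , _ , _ , m≤ = rich j in
               ≤-trans m≤ (inj₂ (≈-sym (ι-length (elements (R j)))))) ⟩
        sum (λ j → sumOver (λ _ → 1#) (elements (R j)))
          ≤⟨ x≤x+y _ (sumOver-nonneg (elements Prem) (λ _ → inj₁ 0<1)) ⟩
        sum (λ j → sumOver (λ _ → 1#) (elements (R j))) + sumOver (λ _ → 1#) (elements Prem)
          ≈⟨ sumOver-partition (λ _ → 1#) (elements ∘ R) (elements Prem) P↭ ⟨
        sumOver (λ _ → 1#) (elements P)
          ≈⟨ ι-length (elements P) ⟩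
        N
          ∎

    -- Once `ε * σ P 𝓢` is added to both sides, the left is `σ P 𝓢`, which splits over the pieces
    -- and the remainder; the strictness comes from the remainder.
    σR> : σ[ 𝓢 ] Prem < ε * σ P 𝓢 → (1# - ε) * σ P 𝓢 < sum (λ j → σ[ 𝓢 ] (R j))
    σR> σPrem< = +-cancelʳ-< (ε * σ P 𝓢) (begin-strict
      (1# - ε) * σ P 𝓢 + ε * σ P 𝓢
        ≈⟨ solve 3 (λ a e s → a :* s :+ e :* s := (a :+ e) :* s) ≈-refl (1# - ε) ε (σ P 𝓢) ⟩
      ((1# - ε) + ε) * σ P 𝓢
        ≈⟨ *-congʳ (x-y+y≈x 1# ε) ⟩
      1# * σ P 𝓢
        ≈⟨ *-identityˡ _ ⟩
      σ P 𝓢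
        ≈⟨ σ≈sumOver-excess 𝓡 𝔽 Q 0<q 𝓢 P ⟩
      σ[ 𝓢 ] P
        ≈⟨ sumOver-partition (excess 𝓢) (elements ∘ R) (elements Prem) P↭ ⟩
      sum (λ j → σ[ 𝓢 ] (R j)) + σ[ 𝓢 ] Prem
        <⟨ +-monoʳ-< _ σPrem< ⟩
      sum (λ j → σ[ 𝓢 ] (R j)) + ε * σ P 𝓢
        ∎)

  -- Multiplied by `K * h`, the numerator becomes `L`, which is `m * (ι 4 * M)`. The bounds on `m`
  -- and `M` then leave a common factor `K * h` to cancel.
  size : ∀ C₁ → M ≤ C₁ * K * h → ∀ R → Rich 𝓡 𝔽 Q 0<q 𝓢 P m R →
         (ε ^ 2 * K * h) / (ι 4 * C₁) ≤ ι ∣ R ∣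
  size C₁ M≤ R (_ , _ , _ , _ , _ , _ , m≤|R|) =
    x≤z*y⇒x/y≤z (*-pos (0<ι {4} ℕ.z<s) 0<C₁) (*-cancelʳ-≤ (*-pos 0<K 0<h) (begin
      ε ^ 2 * K * h * (K * h)
        ≈⟨ solve 3 (λ e k h → e :* k :* h :* (k :* h) := e :* (k :* (k :* con 1)) :* (h :* h))
             ≈-refl (ε ^ 2) K h ⟩
      ε ^ 2 * K ^ 2 * (h * h)
        ≈⟨ *-congˡ (√^-square (0≤ι q) (d ∸ 1)) ⟩
      L
        ≈⟨ m4M≈L ⟨
      m * (ι 4 * M)
        ≤⟨ *-monoʳ-≤ (inj₁ 0<4M) m≤|R| ⟩
      ι ∣ R ∣ * (ι 4 * M)
        ≤⟨ *-monoˡ-≤ (0≤ι ∣ R ∣) (*-monoˡ-≤ (0≤ι 4) M≤) ⟩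
      ι ∣ R ∣ * (ι 4 * (C₁ * K * h))
        ≈⟨ solve 5 (λ r f c k h → r :* (f :* (c :* k :* h)) := r :* (f :* c) :* (k :* h))
             ≈-refl (ι ∣ R ∣) (ι 4) C₁ K h ⟩
      ι ∣ R ∣ * (ι 4 * C₁) * (K * h)
        ∎))
    where
    -- The sign of `C₁` is not given; it follows from `0# < M ≤ C₁ * K * h` with `K` and `h`
    -- positive.
    0<C₁ : 0# < C₁
    0<C₁ = 0<x*y⇒0<x 0<K (0<x*y⇒0<x 0<h (begin-strict 0# <⟨ 0<M ⟩ M ≤⟨ M≤ ⟩ C₁ * K * h ∎))
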